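{- For every $n\ge 5$, the wheel graph $W_n$ with $n$ vertices satisfies \[ \operatorname{nim}(\mathrm{TER}(W_n))=\begin{cases} 2, & n \bmod 34 \in \{5,6,10,11,25,26,30,31\}\\ 1, & \text{otherwise}. \end{cases} \]
   Context: $W_n$ is the graph on $n$ vertices $v_1,\dots,v_{n-1},c$, where the center $c$ is adjacent to every $v_i$, and $v_i$ is adjacent to $v_{i+1}$ (indices modulo $n-1$). For a graph $G$ with vertex set $V$, a set $K\subseteq V$ is convex if it contains every vertex lying on any shortest path between two elements of $K$. The convex hull $[P]$ of $P\subseteq V$ is the smallest convex set containing $P$. The game $\mathrm{TER}(G)$: positions are the sets $P\subseteq V$ reachable from the starting position $\emptyset$ by the following moves. If $[V\setminus P]=V$, then the options of $P$ are all sets $P\cup\{v\}$ with $v\in V\setminus P$; if $[V\setminus P]\neq V$, then $P$ is terminal (has no options). The nim-value of a position is defined recursively by $\operatorname{nim}(p)=\operatorname{mex}\{\operatorname{nim}(q): q\text{ an option of }p\}$, where $\operatorname{mex}(A)$ is the smallest nonnegative integer not in $A$; the nim-value of a game is that of its starting position. -}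

module Defs where

open import Data.Empty using (⊥-elim)
open import Data.Fin using (Fin; zero; suc; toℕ)
open import Data.Fin.Properties using (nonZeroIndex; toℕ<n)
open import Data.Fin.Subset using (Subset; _∈_; _∉_; _⊆_; _⊃_; _∪_; ∁; ⁅_⁆; ⊤; ⊥)
open import Data.Fin.Subset.Induction using (⊃-wellFounded)
open import Data.Fin.Subset.Properties using (p⊆p∪q; q⊆p∪q; x∈⁅x⁆)
open import Data.List using (List; []; _∷_)
open import Data.List.Relation.Unary.All using (All)
open import Data.List.Relation.Unary.Unique.Propositional using (Unique)
open import Data.Nat using (ℕ; suc; _≤_; _<_; s≤s; z≤n)
open import Data.Nat.DivMod using (_%_; m<n⇒m%n≡m; n%n≡0)
open import Data.Nat.Properties
  using (<-cmp; ≤-trans; <-irrefl; 1+n≢n; m≤n⇒m<n∨m≡n)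
open import Data.Product using (∃-syntax; _×_; _,_; proj₁; proj₂)
open import Data.Sum using (inj₁; inj₂)
open import Induction.WellFounded using (WellFounded; Acc; acc; module Subrelation)
open import Level using (0ℓ)
open import Relation.Binary using (Rel; Symmetric; tri<; tri≈; tri>)
open import Relation.Binary.Construct.Closure.ReflexiveTransitive
  using (Star; ε; _◅_; _◅◅_)
open import Relation.Binary.PropositionalEquality
  using (_≡_; refl; sym; trans; cong; subst)
open import Relation.Nullary using (¬_)

------------------------------------------------------------------------
-- Finite simple graphs and geodesic convexity

record Graph (n : ℕ) : Set₁ where
  field
    Adj        : Rel (Fin n) 0ℓ
    adj-sym    : Symmetric Adj
    adj-irrefl : ∀ {v} → ¬ Adj v v

module _ {n : ℕ} (G : Graph n) where
  open Graph G

  Walk : Rel (Fin n) 0ℓ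
  Walk = Star Adj

  -- Number of edges.
  walkLength : ∀ {u v} → Walk u v → ℕ
  walkLength ε       = 0
  walkLength (_ ◅ w) = suc (walkLength w)

  -- Both endpoints are included.
  vertices : ∀ {u v} → Walk u v → List (Fin n)
  vertices {u} ε       = u ∷ []
  vertices {u} (_ ◅ w) = u ∷ vertices w

  IsPath : ∀ {u v} → Walk u v → Set
  IsPath w = Unique (vertices w)

  IsShortestPath : ∀ {u v} → Walk u v → Set
  IsShortestPath {u} {v} p =
    IsPath p × (∀ (q : Walk u v) → IsPath q → walkLength p ≤ walkLength q)

  Convex : Subset n → Set
  Convex K = ∀ {u v} → u ∈ K → v ∈ K →
             (p : Walk u v) → IsShortestPath p → All (_∈ K) (vertices p)

  -- IsConvexHull P H says that [P] = H.
  IsConvexHull : Subset n → Subset n → Set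
  IsConvexHull P H =
    Convex H × P ⊆ H × (∀ K → Convex K → P ⊆ K → H ⊆ K)

------------------------------------------------------------------------
-- Impartial games and nim-values

record Game : Set₁ where
  field
    State       : Set
    start       : State
    _⟶_         : Rel State 0ℓ   -- p ⟶ q: q is an option of p
    wellFounded : WellFounded (λ q p → p ⟶ q)

  -- The positions of the game are the states reachable from start.
  IsPosition : State → Set
  IsPosition = Star _⟶_ start

IsMex : (ℕ → Set) → ℕ → Set
IsMex A m = ¬ A m × (∀ {k} → k < m → A k)

module _ (Γ : Game) where
  open Game Γ

  -- Values of ν at states that are not positions are irrelevant.
  IsNim : (State → ℕ) → Set
  IsNim ν = ∀ p → IsPosition p →
            IsMex (λ k → ∃[ q ] (p ⟶ q × ν q ≡ k)) (ν p)

  HasNimValue : ℕ → Set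
  HasNimValue k = ∃[ ν ] (IsNim ν × ν start ≡ k)

  -- The recursion for nim determines it on all positions, so a game has at
  -- most one nim-value.
  nim-unique : ∀ {ν μ} → IsNim ν → IsNim μ → ∀ p → IsPosition p → ν p ≡ μ p
  nim-unique {ν} {μ} isν isμ p = go p (wellFounded p)
    where
    go : ∀ p → Acc (λ q p → p ⟶ q) p → IsPosition p → ν p ≡ μ p
    go p (acc rs) r with <-cmp (ν p) (μ p)
    ... | tri≈ _ eq _ = eq
    ... | tri< lt _ _ =
      let (q , m , e) = proj₂ (isμ p r) lt
      in ⊥-elim (proj₁ (isν p r)
           (q , m , trans (go q (rs m) (r ◅◅ (m ◅ ε))) e))
    ... | tri> _ _ gt =
      let (q , m , e) = proj₂ (isν p r) gt
      in ⊥-elim (proj₁ (isμ p r)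
           (q , m , trans (sym (go q (rs m) (r ◅◅ (m ◅ ε)))) e))

  nimValue-unique : ∀ {j k} → HasNimValue j → HasNimValue k → j ≡ k
  nimValue-unique (ν , isν , refl) (μ , isμ , refl) =
    nim-unique isν isμ start ε

------------------------------------------------------------------------
-- The game TER

module _ {n : ℕ} (G : Graph n) where

  TERMove : Rel (Subset n) 0ℓ
  TERMove P Q =
    IsConvexHull G (∁ P) ⊤ × ∃[ v ] (v ∉ P × Q ≡ P ∪ ⁅ v ⁆)

  TER : Game
  TER = record
    { State       = Subset n
    ; start       = ⊥
    ; _⟶_         = TERMove
    ; wellFounded = Subrelation.wellFounded grows ⊃-wellFounded
    }
    where
    grows : ∀ {Q P} → TERMove P Q → Q ⊃ P
    grows {_} {P} (_ , v , v∉P , refl) =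
      p⊆p∪q ⁅ v ⁆ , v , q⊆p∪q P ⁅ v ⁆ (x∈⁅x⁆ v) , v∉P

------------------------------------------------------------------------
-- The wheel graph

-- Indices are shifted: i : Fin m stands for the rim vertex v_{i+1}.
RimNext : ∀ {m} → Rel (Fin m) 0ℓ
RimNext {m} i j = toℕ j ≡ (suc (toℕ i) % m) {{nonZeroIndex i}}

-- The center is zero and the rim vertices are suc i, with i : Fin (n - 1).
data WheelAdj {m : ℕ} : Rel (Fin (suc m)) 0ℓ where
  center-rim : ∀ {i}   → WheelAdj zero (suc i)
  rim-center : ∀ {i}   → WheelAdj (suc i) zero
  rim-next   : ∀ {i j} → RimNext i j → WheelAdj (suc i) (suc j)
  rim-prev   : ∀ {i j} → RimNext j i → WheelAdj (suc i) (suc j)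

rimNext-irrefl : ∀ {m} → 2 ≤ m → {i : Fin m} → ¬ RimNext i i
rimNext-irrefl {m} 2≤m {i} eq = helper (m≤n⇒m<n∨m≡n (toℕ<n i)) eq
  where
  instance _ = nonZeroIndex i
  helper : _ → ¬ (toℕ i ≡ suc (toℕ i) % m)
  helper (inj₁ lt) e = 1+n≢n (sym (trans e (m<n⇒m%n≡m lt)))
  helper (inj₂ s≡m) e =
    <-irrefl refl (subst (2 ≤_) (trans (sym s≡m) (cong suc i≡0)) 2≤m)
    where
    i≡0 : toℕ i ≡ 0
    i≡0 = trans e (trans (cong (_% m) s≡m) (n%n≡0 m))

W : (n : ℕ) → 5 ≤ n → Graph n
W (suc m) (s≤s 4≤m) = record
  { Adj        = WheelAdj
  ; adj-sym    = λ where
      center-rim   → rim-center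
      rim-center   → center-rim
      (rim-next e) → rim-prev e
      (rim-prev e) → rim-next e
  ; adj-irrefl = λ where
      (rim-next e) → rimNext-irrefl 2≤m e
      (rim-prev e) → rimNext-irrefl 2≤m e
  }
  where
  2≤m : 2 ≤ m
  2≤m = ≤-trans (s≤s (s≤s z≤n)) 4≤m

{-# OPTIONS --safe #-}

-- For m = n - 1 ≥ 4 rim vertices, the hull of the complement of P is everything
-- exactly when no two cyclically adjacent rim vertices lie in P.  So the game
-- ends when two adjacent rim vertices have been selected, and once a rim vertex
-- is selected such a move is always available.  Up to a shift of all nim-values
-- by one it can be ignored, and what is left is a sum of Dawson's Kayles rows,
-- one for each gap on the rim, and of a heap of size one, the center.  A first
-- move on the rim leaves a row of n - 3 skittles with value d, so the start has
-- the options 0 (the center) and 1 + (d ⊕ 1): its nim-value is 2 if d = 1, and 1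
-- otherwise.  The values of Dawson's Kayles have period 34 from 53 on.

module Submission where

open import Defs
open import Data.Bool using (if_then_else_)
open import Data.List using ([]; _∷_)
open import Data.List.Membership.DecPropositional using (_∈?_)
open import Data.Nat using (ℕ; _≤_; _≟_)
open import Data.Nat.DivMod using (_%_)
open import Relation.Nullary using (does)

open import Data.Bool using (Bool; true; false; _xor_)
open import Data.Bool.Properties using (∨-identityʳ; xor-assoc; xor-comm; xor-identityʳ; xor-same) renaming (_≟_ to _≟ᵇ_)
open import Data.Empty using (⊥-elim)
open import Data.Fin as Fin using (Fin; zero; suc; toℕ; fromℕ; fromℕ<; inject₁)
open import Data.Fin.Properties using (nonZeroIndex; toℕ<n; toℕ-fromℕ; toℕ-fromℕ<; toℕ-inject₁; toℕ-injective) renaming (suc-injective to Fin-suc-injective)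
open import Data.Fin.Subset using (Subset; _∈_; _∉_; _⊆_; _∪_; ∁; ⁅_⁆; ⊤; ⊥; Nonempty)
open import Data.Fin.Subset.Properties using (nonempty?; Empty-unique; ∪-identityˡ; ∪-identityʳ; ∉⊥; drop-there; ∈⊤; x∈⁅x⁆; x∈⁅y⁆⇒x≡y; x∈p∪q⁻; x∈p∪q⁺; x∉p⇒x∈∁p; x∈∁p⇒x∉p) renaming (_∈?_ to _∈ₛ?_)
open import Data.List using (List)
open import Data.List.Relation.Binary.Permutation.Propositional using (_↭_; ↭-refl; ↭-sym; ↭-trans; ↭-reflexive; prep; swap)
open import Data.List.Relation.Binary.Permutation.Propositional.Properties using (All-resp-↭)
open import Data.List.Relation.Unary.All using (All; []; _∷_; all?; universal)
open import Data.List.Relation.Unary.AllPairs using ([]; _∷_)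
open import Data.Nat using (zero; suc; _+_; _∸_; _^_; _<_; _<ᵇ_; _<?_; _≤?_; pred; z≤n; s≤s)
open import Data.Nat.DivMod using ([m+n]%n≡m%n; m<n⇒m%n≡m; n%n≡0; m%n<n)
open import Data.Nat.Induction using (<-rec)
open import Data.Nat.Properties hiding (_≟_; _<?_; _≤?_)
open import Data.Product using (∃-syntax; _×_; _,_; proj₁; proj₂)
open import Data.Sum using (_⊎_; inj₁; inj₂)
open import Data.Vec using (Vec; []; _∷_; here; there; zipWith; replicate)
open import Data.Vec.Properties using (zipWith-assoc; zipWith-comm; zipWith-identityʳ)
open import Function using (_∘_)
open import Relation.Binary.Construct.Closure.ReflexiveTransitive using (ε; _◅_)
open import Relation.Binary.PropositionalEquality using (_≡_; _≢_; refl; sym; trans; cong; cong₂; subst; subst₂)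
open import Relation.Nullary using (¬_; Dec; yes; no; ofʸ; ofⁿ)
open import Relation.Nullary.Decidable using (toWitness; ¬?; _×-dec_; dec-true; dec-false)

-- Nimbers: addition and order

infixl 6 _⊕_
infix  4 _≺_

-- Nimbers below 2 ^ n, most significant bit first.
Nimber : ℕ → Set
Nimber = Vec Bool

_⊕_ : ∀ {n} → Nimber n → Nimber n → Nimber n
_⊕_ = zipWith _xor_

𝟎 : ∀ {n} → Nimber n
𝟎 = replicate _ false

⊕-comm : ∀ {n} (a b : Nimber n) → a ⊕ b ≡ b ⊕ a
⊕-comm = zipWith-comm xor-comm

⊕-assoc : ∀ {n} (a b c : Nimber n) → a ⊕ b ⊕ c ≡ a ⊕ (b ⊕ c)
⊕-assoc = zipWith-assoc xor-assoc

⊕-identityʳ : ∀ {n} (a : Nimber n) → a ⊕ 𝟎 ≡ a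
⊕-identityʳ = zipWith-identityʳ xor-identityʳ

⊕-self : ∀ {n} (a : Nimber n) → a ⊕ a ≡ 𝟎
⊕-self []      = refl
⊕-self (x ∷ a) = cong₂ _∷_ (xor-same x) (⊕-self a)

⊕-cancelʳ : ∀ {n} (a b : Nimber n) → a ⊕ b ⊕ b ≡ a
⊕-cancelʳ a b = trans (⊕-assoc a b b) (trans (cong (a ⊕_) (⊕-self b)) (⊕-identityʳ a))

⊕-cancelˡ : ∀ {n} (a b : Nimber n) → a ⊕ (a ⊕ b) ≡ b
⊕-cancelˡ a b = trans (⊕-comm a (a ⊕ b)) (trans (cong (_⊕ a) (⊕-comm a b)) (⊕-cancelʳ b a))

⊕-injectiveˡ : ∀ {n} (b : Nimber n) {a c} → a ⊕ b ≡ c ⊕ b → a ≡ c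
⊕-injectiveˡ b {a} {c} e =
  trans (sym (⊕-cancelʳ a b)) (trans (cong (_⊕ b) e) (⊕-cancelʳ c b))

⊕-injectiveʳ : ∀ {n} (a : Nimber n) {b c} → a ⊕ b ≡ a ⊕ c → b ≡ c
⊕-injectiveʳ a {b} {c} e =
  trans (sym (⊕-cancelˡ a b)) (trans (cong (a ⊕_) e) (⊕-cancelˡ a c))

⟦_⟧ : ∀ {n} → Nimber n → ℕ
⟦ [] ⟧                  = 0
⟦_⟧ {suc n} (false ∷ a) = ⟦ a ⟧
⟦_⟧ {suc n} (true ∷ a)  = 2 ^ n + ⟦ a ⟧

bits : ∀ n → ℕ → Nimber n
bits zero    k = []
bits (suc n) k =
  if k <ᵇ 2 ^ n then false ∷ bits n k else true ∷ bits n (k ∸ 2 ^ n)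

-- Lexicographic order, which agrees with the order of the numbers `⟦_⟧`: after the first differing
-- bit the tails may be arbitrary.
data _≺_ : ∀ {n} → Nimber n → Nimber n → Set where
  here  : ∀ {n} {a b : Nimber n} → false ∷ a ≺ true ∷ b
  there : ∀ {n x} {a b : Nimber n} → a ≺ b → x ∷ a ≺ x ∷ b

2^-suc : ∀ n → 2 ^ suc n ≡ 2 ^ n + 2 ^ n
2^-suc n = cong (2 ^ n +_) (+-identityʳ (2 ^ n))

⟦⟧<2^n : ∀ {n} (a : Nimber n) → ⟦ a ⟧ < 2 ^ n
⟦⟧<2^n []                  = s≤s z≤n
⟦⟧<2^n {suc n} (false ∷ a) = <-≤-trans (⟦⟧<2^n a) (m≤m+n (2 ^ n) _)
⟦⟧<2^n {suc n} (true ∷ a)  =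
  subst (2 ^ n + ⟦ a ⟧ <_) (sym (2^-suc n)) (+-monoʳ-< (2 ^ n) (⟦⟧<2^n a))

⟦bits⟧ : ∀ n {k} → k < 2 ^ n → ⟦ bits n k ⟧ ≡ k
⟦bits⟧ zero    (s≤s z≤n) = refl
⟦bits⟧ (suc n) {k} k<2^sn with k <ᵇ 2 ^ n | <ᵇ-reflects-< k (2 ^ n)
... | true  | ofʸ k<2^n = ⟦bits⟧ n k<2^n
... | false | ofⁿ k≮2^n = trans (cong (2 ^ n +_) (⟦bits⟧ n k∸<)) (m+[n∸m]≡n 2^n≤k)
  where
  2^n≤k = ≮⇒≥ k≮2^n
  k∸< : k ∸ 2 ^ n < 2 ^ n
  k∸< = +-cancelˡ-< (2 ^ n) _ _
          (subst₂ _<_ (sym (m+[n∸m]≡n 2^n≤k)) (2^-suc n) k<2^sn)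

≺⇒< : ∀ {n} {a b : Nimber n} → a ≺ b → ⟦ a ⟧ < ⟦ b ⟧
≺⇒< (here {n} {a} {b})      = <-≤-trans (⟦⟧<2^n a) (m≤m+n (2 ^ n) ⟦ b ⟧)
≺⇒< (there {x = false} a≺b) = ≺⇒< a≺b
≺⇒< {suc n} (there {x = true} a≺b)  = +-monoʳ-< (2 ^ n) (≺⇒< a≺b)

<⇒≺ : ∀ {n} (a : Nimber n) {k} → k < ⟦ a ⟧ → ∃[ c ] (c ≺ a × ⟦ c ⟧ ≡ k)
<⇒≺ {suc n} (false ∷ a) k< = let c , c≺a , eq = <⇒≺ a k< in false ∷ c , there c≺a , eq
<⇒≺ {suc n} (true ∷ a) {k} k< with k <? 2 ^ n
-- Once the leading bit is cleared any lower bits are allowed, so those of k will do.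
... | yes k<2^n = false ∷ bits n k , here , ⟦bits⟧ n k<2^n
... | no  k≮2^n =
  let c , c≺a , eq = <⇒≺ a k∸<
  in true ∷ c , there c≺a , trans (cong (2 ^ n +_) eq) (m+[n∸m]≡n 2^n≤k)
  where
  2^n≤k = ≮⇒≥ k≮2^n
  k∸< : k ∸ 2 ^ n < ⟦ a ⟧
  k∸< = +-cancelˡ-< (2 ^ n) _ _ (subst (_< _) (sym (m+[n∸m]≡n 2^n≤k)) k<)

⟦⟧-injective : ∀ {n} (a b : Nimber n) → ⟦ a ⟧ ≡ ⟦ b ⟧ → a ≡ b
⟦⟧-injective []          []          _ = refl
⟦⟧-injective (false ∷ a) (false ∷ b) e = cong (false ∷_) (⟦⟧-injective a b e)
⟦⟧-injective {suc n} (true ∷ a) (true ∷ b) e =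
  cong (true ∷_) (⟦⟧-injective a b (+-cancelˡ-≡ (2 ^ n) _ _ e))
⟦⟧-injective (false ∷ a) (true ∷ b)  e =
  ⊥-elim (<-irrefl e (≺⇒< (here {a = a} {b})))
⟦⟧-injective (true ∷ a)  (false ∷ b) e =
  ⊥-elim (<-irrefl (sym e) (≺⇒< (here {a = b} {a})))

𝟎-minimal : ∀ {n} {c : Nimber n} → ¬ (c ≺ 𝟎)
𝟎-minimal (there c≺𝟎) = 𝟎-minimal c≺𝟎

-- At the highest bit where c and `a ⊕ b` differ, `a ⊕ b` has a 1, so exactly one summand does.
-- Clearing it there leaves the lower bits of that summand free, and these are chosen to make the
-- sum c.
≺-⊕ : ∀ {n} (a b : Nimber n) {c} → c ≺ a ⊕ b →
      (∃[ a′ ] (a′ ≺ a × a′ ⊕ b ≡ c)) ⊎ (∃[ b′ ] (b′ ≺ b × a ⊕ b′ ≡ c))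
≺-⊕ (true ∷ a) (false ∷ b) (here {a = c}) =
  inj₁ (false ∷ (c ⊕ b) , here , cong (false ∷_) (⊕-cancelʳ c b))
≺-⊕ (false ∷ a) (true ∷ b) (here {a = c}) =
  inj₂ (false ∷ (a ⊕ c) , here , cong (false ∷_) (⊕-cancelˡ a c))
≺-⊕ (x ∷ a) (y ∷ b) (there c≺) with ≺-⊕ a b c≺
... | inj₁ (a′ , a′≺a , e) = inj₁ (x ∷ a′ , there a′≺a , cong ((x xor y) ∷_) e)
... | inj₂ (b′ , b′≺b , e) = inj₂ (y ∷ b′ , there b′≺b , cong ((x xor y) ∷_) e)

-- Mex and sums of games

Mex : ∀ {n} → (Nimber n → Set) → Nimber n → Set
Mex A a = ¬ A a × (∀ {c} → c ≺ a → A c)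

Mex-resp : ∀ {n} {A B : Nimber n → Set} {a} →
           (∀ {c} → A c → B c) → (∀ {c} → B c → A c) → Mex A a → Mex B a
Mex-resp A⇒B B⇒A (¬Aa , below) = ¬Aa ∘ B⇒A , A⇒B ∘ below

Sum : ∀ {n} → (Nimber n → Set) → Nimber n → (Nimber n → Set) → Nimber n → (Nimber n → Set)
Sum A a B b c = (∃[ a′ ] (A a′ × a′ ⊕ b ≡ c)) ⊎ (∃[ b′ ] (B b′ × a ⊕ b′ ≡ c))

-- The Sprague-Grundy argument: a move changes the value of one summand, hence by cancellation the
-- sum; every smaller nimber is reached by lowering one summand as in `≺-⊕`.
Mex-⊕ : ∀ {n} {A B : Nimber n → Set} {a b} →
        Mex A a → Mex B b → Mex (Sum A a B b) (a ⊕ b)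
Mex-⊕ {A = A} {B} {a} {b} (¬Aa , belowA) (¬Bb , belowB) = not , below
  where
  not : ¬ Sum A a B b (a ⊕ b)
  not (inj₁ (a′ , Aa′ , e)) = ¬Aa (subst A (⊕-injectiveˡ b e) Aa′)
  not (inj₂ (b′ , Bb′ , e)) = ¬Bb (subst B (⊕-injectiveʳ a e) Bb′)
  below : ∀ {c} → c ≺ a ⊕ b → Sum A a B b c
  below c≺ with ≺-⊕ a b c≺
  ... | inj₁ (a′ , a′≺a , e) = inj₁ (a′ , belowA a′≺a , e)
  ... | inj₂ (b′ , b′≺b , e) = inj₂ (b′ , belowB b′≺b , e)

-- Dawson's Kayles

nth : List ℕ → ℕ → ℕ
nth []       _       = 0
nth (d ∷ _)  zero    = d
nth (_ ∷ ds) (suc n) = nth ds n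

preperiod period : List ℕ
preperiod =
  0 ∷ 0 ∷ 1 ∷ 1 ∷ 2 ∷ 0 ∷ 3 ∷ 1 ∷ 1 ∷ 0 ∷ 3 ∷ 3 ∷ 2 ∷ 2 ∷ 4 ∷ 0 ∷ 5 ∷
  2 ∷ 2 ∷ 3 ∷ 3 ∷ 0 ∷ 1 ∷ 1 ∷ 3 ∷ 0 ∷ 2 ∷ 1 ∷ 1 ∷ 0 ∷ 4 ∷ 5 ∷ 2 ∷ 7 ∷
  4 ∷ 0 ∷ 1 ∷ 1 ∷ 2 ∷ 0 ∷ 3 ∷ 1 ∷ 1 ∷ 0 ∷ 3 ∷ 3 ∷ 2 ∷ 2 ∷ 4 ∷ 4 ∷ 5 ∷
  5 ∷ 2 ∷ []
period =
  4 ∷ 8 ∷ 1 ∷ 1 ∷ 2 ∷ 0 ∷ 3 ∷ 1 ∷ 1 ∷ 0 ∷ 3 ∷ 3 ∷ 2 ∷ 2 ∷ 4 ∷ 4 ∷ 5 ∷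
  5 ∷ 9 ∷ 3 ∷ 3 ∷ 0 ∷ 1 ∷ 1 ∷ 3 ∷ 0 ∷ 2 ∷ 1 ∷ 1 ∷ 0 ∷ 4 ∷ 5 ∷ 3 ∷ 7 ∷ []

-- `period` is indexed by the residue modulo 34: its head is the value at 68, not at 53.
dawsonℕ : ℕ → ℕ
dawsonℕ s = if s <ᵇ 53 then nth preperiod s else nth period (s % 34)

dawsonℕ-periodic : ∀ {s} → 53 ≤ s → dawsonℕ (34 + s) ≡ dawsonℕ s
-- The test `34 + s <ᵇ 53` reduces to `s <ᵇ 19`.
dawsonℕ-periodic {s} 53≤s with s <ᵇ 53 | <ᵇ-reflects-< s 53 | s <ᵇ 19 | <ᵇ-reflects-< s 19
... | true  | ofʸ s<53 | _     | _        = ⊥-elim (<⇒≱ s<53 53≤s)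
... | _     | _        | true  | ofʸ s<19 = ⊥-elim (<⇒≱ s<19 (≤-trans (m≤m+n 19 34) 53≤s))
... | false | _        | false | _        =
  cong (nth period) (trans (cong (_% 34) (+-comm 34 s)) ([m+n]%n≡m%n s 34))

-- The nim-value of a row of s skittles from which a move removes two adjacent
-- ones.
opaque
  dawson : ℕ → Nimber 4
  dawson s = bits 4 (dawsonℕ s)

opaque
  unfolding dawson

  dawson-periodic : ∀ {s} → 53 ≤ s → dawson (34 + s) ≡ dawson s
  dawson-periodic 53≤s = cong (bits 4) (dawsonℕ-periodic 53≤s)

KaylesOption : ∀ {w} → (ℕ → Nimber w) → ℕ → Nimber w → Set
KaylesOption f s c = ∃[ i ] ∃[ j ] (2 + i + j ≡ s × f i ⊕ f j ≡ c)

dawsonSplit : ℕ → ℕ → ℕ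
dawsonSplit s i = ⟦ dawson i ⊕ dawson (s ∸ (2 + i)) ⟧

-- The mex condition with bounded quantifiers only, hence decidable by evaluation. A move is coded
-- by the size i of one part; a second part exists exactly when `i < s ∸ 1`.
IsDawsonValue : ℕ → Set
IsDawsonValue s =
  (∀ {i} → i < s ∸ 1 → ¬ dawsonSplit s i ≡ ⟦ dawson s ⟧) ×
  (∀ {k} → k < ⟦ dawson s ⟧ → ∃[ i ] (i < s ∸ 1 × dawsonSplit s i ≡ k))

isDawsonValue? : ∀ s → Dec (IsDawsonValue s)
isDawsonValue? s =
  allUpTo? (λ i → ¬? (dawsonSplit s i ≟ ⟦ dawson s ⟧)) (s ∸ 1) ×-dec
  allUpTo? (λ k → anyUpTo? (λ i → dawsonSplit s i ≟ k) (s ∸ 1)) ⟦ dawson s ⟧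

opaque
  unfolding dawson

  -- Checked by evaluation; 176 = 2 + 2 (34 + 53) is the bound from which the periodicity argument
  -- takes over.
  dawson-initial : ∀ {s} → s < 176 → IsDawsonValue s
  dawson-initial = toWitness {a? = allUpTo? isDawsonValue? 176} _

private
  split-<-pred : ∀ {s i j} → 2 + i + j ≡ s → i < s ∸ 1
  split-<-pred {i = i} {j} refl = s≤s (m≤m+n i j)

  split-∸ : ∀ {s i j} → 2 + i + j ≡ s → s ∸ (2 + i) ≡ j
  split-∸ {i = i} {j} refl = m+n∸m≡n i j

  <-pred-split : ∀ {s i} → i < s ∸ 1 → 2 + i + (s ∸ (2 + i)) ≡ s
  <-pred-split {suc s} i<s = m+[n∸m]≡n (s≤s i<s)

IsDawsonValue⇒Mex : ∀ s → IsDawsonValue s → Mex (KaylesOption dawson s) (dawson s)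
IsDawsonValue⇒Mex s (differ , reach) = not , below
  where
  not : ¬ KaylesOption dawson s (dawson s)
  not (i , j , eq , e) =
    differ (split-<-pred eq)
      (cong ⟦_⟧ (trans (cong (λ j′ → dawson i ⊕ dawson j′) (split-∸ eq)) e))
  below : ∀ {c} → c ≺ dawson s → KaylesOption dawson s c
  below {c} c≺ =
    let i , i< , e = reach (≺⇒< c≺)
    in i , s ∸ (2 + i) , <-pred-split i< , ⟦⟧-injective _ c e

-- In a row of at least 2 + 2 (p + N) skittles one of the two parts left by a
-- move can be shortened by p, so the options have the same values as those of
-- the row shorter by p.
module _ (p N : ℕ) (0<p : 0 < p) {w} (f : ℕ → Nimber w)
         (periodic : ∀ {s} → N ≤ s → f (p + s) ≡ f s) where

  private
    +-shiftʳ : ∀ i j → 2 + i + (p + j) ≡ p + (2 + i + j)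
    +-shiftʳ i j = trans (sym (+-assoc (2 + i) p j))
      (trans (cong (_+ j) (+-comm (2 + i) p)) (+-assoc p (2 + i) j))

    +-shiftˡ : ∀ i j → 2 + (p + i) + j ≡ p + (2 + i + j)
    +-shiftˡ i j = trans (cong (λ k → 2 + (k + j)) (+-comm p i))
      (trans (cong (2 +_) (+-assoc i p j)) (+-shiftʳ i j))

    large-part : ∀ M {s} i j → 2 + i + j ≡ s → 2 + (M + M) ≤ s → M ≤ i ⊎ M ≤ j
    large-part M i j eq 2+M+M≤s with M ≤? i | M ≤? j
    ... | yes M≤i | _       = inj₁ M≤i
    ... | no _    | yes M≤j = inj₂ M≤j
    ... | no M≰i  | no M≰j  =
      ⊥-elim (<-irrefl eq (<-≤-trans (s≤s (s≤s (+-mono-< (≰⇒> M≰i) (≰⇒> M≰j)))) 2+M+M≤s))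

    shorten : ∀ {M i} → p + M ≤ i → ∃[ i′ ] (i ≡ p + i′ × M ≤ i′)
    shorten {M} {i} p+M≤i = i ∸ p , eq , +-cancelˡ-≤ p M _ (subst (p + M ≤_) eq p+M≤i)
      where eq = sym (m+[n∸m]≡n (≤-trans (m≤m+n p M) p+M≤i))

    raise : ∀ {s c} → 2 + (N + N) ≤ s → KaylesOption f s c → KaylesOption f (p + s) c
    raise s≥ (i , j , eq , e) with large-part N i j eq s≥
    ... | inj₁ N≤i = p + i , j , trans (+-shiftˡ i j) (cong (p +_) eq) , trans (cong (_⊕ f j) (periodic N≤i)) e
    ... | inj₂ N≤j = i , p + j , trans (+-shiftʳ i j) (cong (p +_) eq) ,
      trans (cong (f i ⊕_) (periodic N≤j)) e

    -- The large part must have p + N skittles here, so that at least N are left when p are taken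
    -- off.
    lower : ∀ {s c} → 2 + (p + N + (p + N)) ≤ p + s → KaylesOption f (p + s) c → KaylesOption f s c
    lower s≥ (i , j , eq , e) with large-part (p + N) i j eq s≥
    ... | inj₁ i≥ = let i′ , i≡ , N≤i′ = shorten i≥ in
      i′ , j ,
      +-cancelˡ-≡ p _ _ (trans (sym (+-shiftˡ i′ j)) (trans (cong (λ i → 2 + i + j) (sym i≡)) eq)) ,
      trans (cong (_⊕ f j) (trans (sym (periodic N≤i′)) (cong f (sym i≡)))) e
    ... | inj₂ j≥ = let j′ , j≡ , N≤j′ = shorten j≥ in
      i , j′ ,
      +-cancelˡ-≡ p _ _ (trans (sym (+-shiftʳ i j′)) (trans (cong (2 + i +_) (sym j≡)) eq)) ,
      trans (cong (f i ⊕_) (trans (sym (periodic N≤j′)) (cong f (sym j≡)))) e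

  periodic⇒Mex : (∀ {s} → s < 2 + (p + N + (p + N)) → Mex (KaylesOption f s) (f s)) →
                 ∀ s → Mex (KaylesOption f s) (f s)
  periodic⇒Mex initial = <-rec _ step
    where
    B = 2 + (p + N + (p + N))
    step : ∀ s → (∀ {t} → t < s → Mex (KaylesOption f t) (f t)) → Mex (KaylesOption f s) (f s)
    step s rec with s <? B
    ... | yes s<B = initial s<B
    ... | no  s≮B =
      subst (λ s → Mex (KaylesOption f s) (f s)) (sym s≡)
        (subst (Mex (KaylesOption f (p + t))) (sym (periodic N≤t))
          (Mex-resp (raise t≥) (lower (subst (B ≤_) s≡ (≮⇒≥ s≮B)))
            (rec (subst (t <_) (sym s≡) (m<n+m t 0<p)))))
      where
      -- Regrouped so that `shorten` takes one p off s and leaves a bound on t that yields both `t≥`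
      -- and `N≤t`.
      B≡ : p + (2 + (N + (p + N))) ≡ B
      B≡ = trans (sym (+-assoc p 2 _)) (trans (cong (_+ (N + (p + N))) (+-comm p 2))
             (cong (2 +_) (sym (+-assoc p N (p + N)))))
      short = shorten (subst (_≤ s) (sym B≡) (≮⇒≥ s≮B))
      t   = proj₁ short
      s≡  = proj₁ (proj₂ short)
      t≥  : 2 + (N + N) ≤ t
      t≥  = ≤-trans (+-monoʳ-≤ 2 (+-monoʳ-≤ N (m≤n+m N p))) (proj₂ (proj₂ short))
      N≤t : N ≤ t
      N≤t = ≤-trans (m≤n+m N (2 + N)) t≥

dawson-mex : ∀ s → Mex (KaylesOption dawson s) (dawson s)
dawson-mex = periodic⇒Mex 34 53 (s≤s z≤n) dawson dawson-periodic
               (λ {s} s<176 → IsDawsonValue⇒Mex s (dawson-initial s<176))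

-- The game on lists of gaps

infix 4 _⇒_

-- Positions as lists of gaps between consecutive selected vertices of a cycle;
-- a gap of size 0 witnesses two adjacent selected vertices.

data _⇒_ : List ℕ → List ℕ → Set where
  split : ∀ {g gs} i j → g ≡ i + suc j → g ∷ gs ⇒ i ∷ j ∷ gs
  skip  : ∀ {g gs gs′} → gs ⇒ gs′ → g ∷ gs ⇒ g ∷ gs′

Apart : List ℕ → Set
Apart = All (1 ≤_)

-- A move leaves at least one vertex on either side in a gap, so a gap g acts as
-- a row of g - 1 skittles: selecting a vertex removes two of them.
value : List ℕ → Nimber 4
value []       = 𝟎
value (g ∷ gs) = dawson (pred g) ⊕ value gs

GapsOption : List ℕ → Nimber 4 → Set
GapsOption gs c = ∃[ gs′ ] (gs ⇒ gs′ × Apart gs′ × value gs′ ≡ c)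

-- The first gap and the rest form a sum of games. A move that keeps all gaps positive cuts g + 1
-- into i + 1 and j + 1 with 2 + i + j = g, which is a move in a row of g skittles.
value-mex : ∀ {gs} → Apart gs → Mex (GapsOption gs) (value gs)
value-mex [] = (λ where (_ , () , _)) , ⊥-elim ∘ 𝟎-minimal
value-mex {suc g ∷ gs} (1≤g ∷ apart) =
  Mex-resp to from (Mex-⊕ (dawson-mex g) (value-mex apart))
  where
  S = Sum (KaylesOption dawson g) (dawson g) (GapsOption gs) (value gs)
  to : ∀ {c} → S c → GapsOption (suc g ∷ gs) c
  to (inj₁ (_ , (i , j , eq , refl) , refl)) =
    suc i ∷ suc j ∷ gs ,
    split (suc i) (suc j) (cong suc (trans (sym eq) (sym (trans (+-suc i (suc j)) (cong suc (+-suc i j)))))) ,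
    s≤s z≤n ∷ s≤s z≤n ∷ apart , sym (⊕-assoc (dawson i) (dawson j) (value gs))
  to (inj₂ (_ , (gs′ , m , apart′ , refl) , e)) = suc g ∷ gs′ , skip m , 1≤g ∷ apart′ , e
  from : ∀ {c} → GapsOption (suc g ∷ gs) c → S c
  from (_ , split (suc i) (suc j) eq , s≤s _ ∷ s≤s _ ∷ _ , e) =
    inj₁ (_ , (i , j , sym (trans (suc-injective eq) (trans (+-suc i (suc j)) (cong suc (+-suc i j)))) , refl) ,
          trans (⊕-assoc (dawson i) (dawson j) (value gs)) e)
  from (_ , skip m , _ ∷ apart′ , e) = inj₂ (_ , (_ , m , apart′ , refl) , e)

-- Needed because a selection in the gap around the closing point can put the new gaps at other
-- places of the list.
value-↭ : ∀ {gs gs′} → gs ↭ gs′ → value gs ≡ value gs′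
value-↭ _↭_.refl         = refl
value-↭ (prep g p)   = cong (dawson (pred g) ⊕_) (value-↭ p)
value-↭ (swap g h p) =
  trans (sym (⊕-assoc a b _)) (trans (cong₂ _⊕_ (⊕-comm a b) (value-↭ p)) (⊕-assoc b a _))
  where
  a = dawson (pred g)
  b = dawson (pred h)
value-↭ (_↭_.trans p q)  = trans (value-↭ p) (value-↭ q)

-- Gap lists of sets of rim vertices

-- The gaps of x as part of a line, with r unselected vertices before it and e
-- after it.
segment : ∀ {k} → ℕ → ℕ → Subset k → List ℕ
segment r e []          = r + e ∷ []
segment r e (false ∷ x) = segment (suc r) e x
segment r e (true ∷ x)  = r ∷ segment 0 e x

-- The gaps of x closed up to a cycle by l unselected vertices; the gap around
-- the closing point comes last.
cyclic : ∀ {k} → ℕ → Subset k → List ℕ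
cyclic l []          = []
cyclic l (false ∷ x) = cyclic (suc l) x
cyclic l (true ∷ x)  = segment 0 l x

gaps : ∀ {k} → Subset k → List ℕ
gaps = cyclic 0

-- One of the r vertices before x is selected: i stay to its left, j join the first gap of x.
segment-split : ∀ {k r i j} e (x : Subset k) → r ≡ i + suc j →
                segment r e x ⇒ i ∷ segment j e x
segment-split {i = i} {j} e []          eq = split i (j + e) (trans (cong (_+ e) eq) (+-assoc i (suc j) e))
segment-split {i = i} {j} e (false ∷ x) eq =
  segment-split e x (trans (cong suc eq) (sym (+-suc i (suc j))))
segment-split {i = i} {j} e (true ∷ x)  eq = split i j eq

segment-move : ∀ {k} r e (x : Subset k) {v} → v ∉ x → segment r e x ⇒ segment r e (x ∪ ⁅ v ⁆)
segment-move r e (false ∷ x) {zero}  _  =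
  subst (λ y → segment (suc r) e x ⇒ r ∷ segment 0 e y) (sym (∪-identityʳ x))
    (segment-split e x (+-comm 1 r))
segment-move r e (false ∷ x) {suc v} v∉ = segment-move (suc r) e x (v∉ ∘ there)
segment-move r e (true ∷ x)  {zero}  v∉ = ⊥-elim (v∉ here)
segment-move r e (true ∷ x)  {suc v} v∉ = skip (segment-move 0 e x (v∉ ∘ there))

-- One of the e vertices after x is selected: i stay in the last gap of x, and j form a new last
-- gap, which the permutation brings to the front.
segment-split-end : ∀ {k i j e} r (x : Subset k) → e ≡ i + suc j →
                    ∃[ gs ] (segment r e x ⇒ gs × gs ↭ j ∷ segment r i x)
segment-split-end {i = i} {j} r [] eq =
  _ , split (r + i) j (trans (cong (r +_) eq) (sym (+-assoc r i (suc j)))) , swap (r + i) j ↭-refl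
segment-split-end r (false ∷ x) eq = segment-split-end (suc r) x eq
segment-split-end {j = j} r (true ∷ x)  eq =
  let gs , m , p = segment-split-end 0 x eq
  in r ∷ gs , skip m , ↭-trans (prep r p) (swap r j ↭-refl)

-- Selecting one of the l closing vertices cuts the cycle open there, with j of the others before x
-- and i after it.
cyclic-split : ∀ {k l i j} (x : Subset k) → Nonempty x → l ≡ i + suc j →
               ∃[ gs ] (cyclic l x ⇒ gs × gs ↭ segment j i x)
cyclic-split {i = i} {j} (false ∷ x) (suc v , there v∈) eq =
  cyclic-split x (v , v∈) (trans (cong suc eq) (sym (+-suc i (suc j))))
cyclic-split (true ∷ x) _ eq = segment-split-end 0 x eq

-- Nonemptiness matters: an empty selection has no gap, and a first selection is no move between gap
-- lists.
cyclic-move : ∀ {k} l (x : Subset k) {v} → Nonempty x → v ∉ x →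
              ∃[ gs ] (cyclic l x ⇒ gs × gs ↭ cyclic l (x ∪ ⁅ v ⁆))
cyclic-move l (false ∷ x) {zero} (suc v , there v∈) _ =
  subst (λ y → ∃[ gs ] (cyclic (suc l) x ⇒ gs × gs ↭ segment 0 l y)) (sym (∪-identityʳ x))
    (cyclic-split x (v , v∈) (+-comm 1 l))
cyclic-move l (false ∷ x) {suc v} (suc w , there w∈) v∉ =
  cyclic-move (suc l) x (w , w∈) (v∉ ∘ there)
cyclic-move l (true ∷ x) {zero}  _ v∉ = ⊥-elim (v∉ here)
cyclic-move l (true ∷ x) {suc v} _ v∉ = _ , segment-move 0 l x (v∉ ∘ there) , ↭-refl

private
  -- Decides whether the vertex selected in a gap of r + e lies among the first r or the last e.
  locate : ∀ r e i j → r + e ≡ i + suc j →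
           (∃[ k ] (r ≡ i + suc k × j ≡ k + e)) ⊎ (∃[ k ] (i ≡ r + k × e ≡ k + suc j))
  locate zero    e i       j eq = inj₂ (i , refl , eq)
  locate (suc r) e zero    j eq = inj₁ (r , refl , sym (suc-injective eq))
  locate (suc r) e (suc i) j eq with locate r e i j (suc-injective eq)
  ... | inj₁ (k , p , q) = inj₁ (k , cong suc p , q)
  ... | inj₂ (k , p , q) = inj₂ (k , cong suc p , q)

data SegmentMove {k} (r e : ℕ) (x : Subset k) (gs : List ℕ) : Set where
  before : ∀ {i j} → r ≡ i + suc j → gs ≡ i ∷ segment j e x → SegmentMove r e x gs
  within : ∀ {v} → v ∉ x → gs ≡ segment r e (x ∪ ⁅ v ⁆) → SegmentMove r e x gs
  after  : ∀ {i j} → e ≡ i + suc j → gs ↭ j ∷ segment r i x → SegmentMove r e x gs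

segment-move⁻ : ∀ {k} r e (x : Subset k) {gs} → segment r e x ⇒ gs → SegmentMove r e x gs
segment-move⁻ r e [] (split i j eq) with locate r e i j eq
... | inj₁ (k , r≡ , refl) = before r≡ refl
... | inj₂ (k , refl , e≡) = after e≡ (swap _ _ ↭-refl)
segment-move⁻ r e (false ∷ x) m with segment-move⁻ (suc r) e x m
-- With j = 0 the selected vertex is the last of the r + 1 before x, that is, the unselected head
-- just passed.
... | before {i} {zero} eq refl with trans (suc-injective (trans eq (+-comm i 1))) refl
...   | refl = within {v = zero} (λ ()) (cong (λ y → r ∷ segment 0 e y) (sym (∪-identityʳ x)))
segment-move⁻ r e (false ∷ x) m | before {i} {suc j} eq refl =
  before (suc-injective (trans eq (+-suc i (suc j)))) refl
segment-move⁻ r e (false ∷ x) m | within {v} v∉ p = within {v = suc v} (λ where (there v∈) → v∉ v∈) p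
segment-move⁻ r e (false ∷ x) m | after eq p = after eq p
segment-move⁻ r e (true ∷ x) (split i j eq) = before eq refl
segment-move⁻ r e (true ∷ x) (skip m) with segment-move⁻ 0 e x m
... | before {zero} () _
... | before {suc _} () _
... | within {v} v∉ p = within {v = suc v} (λ where (there v∈) → v∉ v∈) (cong (r ∷_) p)
... | after eq p = after eq (↭-trans (prep r p) (swap r _ ↭-refl))

data CyclicMove {k} (l : ℕ) (x : Subset k) (gs : List ℕ) : Set where
  within  : ∀ {v} → v ∉ x → gs ↭ cyclic l (x ∪ ⁅ v ⁆) → CyclicMove l x gs
  closing : ∀ {i j} → l ≡ i + suc j → gs ↭ segment j i x → CyclicMove l x gs

cyclic-move⁻ : ∀ {k} l (x : Subset k) {gs} → cyclic l x ⇒ gs → CyclicMove l x gs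
cyclic-move⁻ l [] ()
cyclic-move⁻ l (false ∷ x) m with cyclic-move⁻ (suc l) x m
... | within {v} v∉ p = within {v = suc v} (λ where (there v∈) → v∉ v∈) p
... | closing {i} {zero} eq p with suc-injective (trans eq (+-comm i 1))
...   | refl = within {v = zero} (λ ()) (subst (λ y → _ ↭ segment 0 l y) (sym (∪-identityʳ x)) p)
cyclic-move⁻ l (false ∷ x) m | closing {i} {suc j} eq p =
  closing (suc-injective (trans eq (+-suc i (suc j)))) p
cyclic-move⁻ l (true ∷ x) m with segment-move⁻ 0 l x m
... | before {zero} () _
... | before {suc _} () _
... | within {v} v∉ p = within {v = suc v} (λ where (there v∈) → v∉ v∈) (↭-reflexive p)
... | after eq p = closing eq p

gaps-move⁻ : ∀ {k} (x : Subset k) {gs} → gaps x ⇒ gs →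
             ∃[ v ] (v ∉ x × gs ↭ gaps (x ∪ ⁅ v ⁆))
gaps-move⁻ x m with cyclic-move⁻ 0 x m
... | within v∉ p = _ , v∉ , p
... | closing {zero} () _
... | closing {suc _} () _

cyclic-⊥ : ∀ k l → cyclic {k} l ⊥ ≡ []
cyclic-⊥ zero    l = refl
cyclic-⊥ (suc k) l = cyclic-⊥ k (suc l)

segment-⊥ : ∀ k r e → segment {k} r e ⊥ ≡ k + r + e ∷ []
segment-⊥ zero    r e = refl
segment-⊥ (suc k) r e =
  trans (segment-⊥ k (suc r) e) (cong (λ s → s + e ∷ []) (+-suc k r))

cyclic-⁅⁆ : ∀ {k} l (v : Fin (suc k)) → cyclic l ⁅ v ⁆ ≡ k + l ∷ []
cyclic-⁅⁆ {k} l zero = trans (segment-⊥ k 0 l) (cong (λ s → s + l ∷ []) (+-identityʳ k))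
cyclic-⁅⁆ {suc k} l (suc v) = trans (cyclic-⁅⁆ (suc l) v) (cong (_∷ []) (+-suc k l))

-- Gap sizes and adjacency

Consecutive : ∀ {k} → Fin k → Fin k → Set
Consecutive i j = toℕ j ≡ suc (toℕ i)

Wraps : ∀ {k} → Fin k → Fin k → Set
Wraps {k} i j = toℕ j ≡ 0 × suc (toℕ i) ≡ k

-- One clause for each place of a gap: the only gap of an empty segment, the gap before the first
-- vertex, an inner gap, the gap after the last vertex.
Separated : ∀ {k} → ℕ → ℕ → Subset k → Set
Separated {k} r e x =
  (k ≡ 0 → 1 ≤ r + e) ×
  (∀ {j} → toℕ j ≡ 0 → j ∈ x → 1 ≤ r) ×
  (∀ {i j} → Consecutive i j → i ∈ x → j ∉ x) ×
  (∀ {i} → suc (toℕ i) ≡ k → i ∈ x → 1 ≤ e)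

segment-apart⁺ : ∀ {k} r e (x : Subset k) → Separated r e x → Apart (segment r e x)
segment-apart⁺ r e [] (empty , _) = empty refl ∷ []
segment-apart⁺ r e (false ∷ x) (_ , first , next , last) =
  segment-apart⁺ (suc r) e x
    ( (λ _ → s≤s z≤n) , (λ _ _ → s≤s z≤n)
    , (λ c i∈ j∈ → next (cong suc c) (there i∈) (there j∈))
    , (λ eq i∈ → last (cong suc eq) (there i∈)))
segment-apart⁺ r e (true ∷ x) (_ , first , next , last) =
  first {zero} refl here ∷ segment-apart⁺ 0 e x
    ( (λ { refl → last {zero} refl here })
    , (λ eq j∈ → ⊥-elim (next (cong suc eq) here (there j∈)))
    , (λ c i∈ j∈ → next (cong suc c) (there i∈) (there j∈))
    , (λ eq i∈ → last (cong suc eq) (there i∈)))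

segment-apart⁻ : ∀ {k} r e (x : Subset k) → Apart (segment r e x) → Separated r e x
segment-apart⁻ r e [] (1≤ ∷ []) = (λ _ → 1≤) , (λ {}) , (λ {}) , (λ {})
segment-apart⁻ r e (false ∷ x) apart with segment-apart⁻ (suc r) e x apart
... | _ , _ , next , last = (λ ()) ,
  (λ { {suc _} () _ }) ,
  (λ { {suc i} {suc j} c (there i∈) (there j∈) → next (suc-injective c) i∈ j∈ }) ,
  (λ { {suc i} eq (there i∈) → last (suc-injective eq) i∈ })
segment-apart⁻ r e (true ∷ x) (1≤r ∷ apart) with segment-apart⁻ 0 e x apart
... | empty , first , next , last = (λ ()) ,
  (λ _ _ → 1≤r) ,
  -- The recursive call has r = 0, so `first` gives 1 ≤ 0 if the next vertex is selected as well.
  (λ { {zero} {suc j} c _ (there j∈) → n≮n 0 (first (suc-injective c) j∈)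
     ; {suc i} {suc j} c (there i∈) (there j∈) → next (suc-injective c) i∈ j∈ }) ,
  (λ { {zero} eq _ → empty (sym (suc-injective eq))
     ; {suc i} eq (there i∈) → last (suc-injective eq) i∈ })

CyclicallySeparated : ∀ {k} → ℕ → Subset k → Set
CyclicallySeparated l x =
  (∀ {i j} → Consecutive i j → i ∈ x → j ∉ x) ×
  (∀ {i j} → Wraps i j → i ∈ x → j ∈ x → 1 ≤ l)

cyclic-apart⁺ : ∀ {k} l (x : Subset k) → CyclicallySeparated l x → Apart (cyclic l x)
cyclic-apart⁺ l [] _ = []
cyclic-apart⁺ l (false ∷ x) (next , wrap) =
  cyclic-apart⁺ (suc l) x
    ((λ c i∈ j∈ → next (cong suc c) (there i∈) (there j∈)) , (λ _ _ _ → s≤s z≤n))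
cyclic-apart⁺ l (true ∷ x) (next , wrap) =
  segment-apart⁺ 0 l x
    ( (λ { refl → wrap {zero} {zero} (refl , refl) here here })
    , (λ eq j∈ → ⊥-elim (next (cong suc eq) here (there j∈)))
    , (λ c i∈ j∈ → next (cong suc c) (there i∈) (there j∈))
    , (λ eq i∈ → wrap {j = zero} (refl , cong suc eq) (there i∈) here))

cyclic-apart⁻ : ∀ {k} l (x : Subset k) → Apart (cyclic l x) → CyclicallySeparated l x
cyclic-apart⁻ l [] _ = (λ {}) , (λ {})
cyclic-apart⁻ l (false ∷ x) apart with cyclic-apart⁻ (suc l) x apart
... | next , _ =
  (λ { {suc i} {suc j} c (there i∈) (there j∈) → next (suc-injective c) i∈ j∈ }) ,
  (λ { {_} {suc _} (() , _) _ _ })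
cyclic-apart⁻ l (true ∷ x) apart with segment-apart⁻ 0 l x apart
... | empty , first , next , last =
  (λ { {zero} {suc j} c _ (there j∈) → n≮n 0 (first (suc-injective c) j∈)
     ; {suc i} {suc j} c (there i∈) (there j∈) → next (suc-injective c) i∈ j∈ }) ,
  (λ { {zero} (_ , eq) _ _ → empty (sym (suc-injective eq))
     ; {suc i} (_ , eq) (there i∈) _ → last (suc-injective eq) i∈ })

-- The rim

rimNext⁻ : ∀ {m} {i j : Fin m} → RimNext i j → Consecutive i j ⊎ Wraps i j
rimNext⁻ {m} {i} e with m≤n⇒m<n∨m≡n (toℕ<n i)
... | inj₁ i+1<m = inj₁ (trans e (m<n⇒m%n≡m i+1<m))
  where instance _ = nonZeroIndex i
... | inj₂ i+1≡m = inj₂ (trans e (trans (cong (_% m) i+1≡m) (n%n≡0 m)) , i+1≡m)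
  where instance _ = nonZeroIndex i

rimNext⁺ : ∀ {m} {i j : Fin m} → Consecutive i j ⊎ Wraps i j → RimNext i j
rimNext⁺ {m} {i} {j} (inj₁ e) = trans e (sym (m<n⇒m%n≡m (subst (_< m) e (toℕ<n j))))
  where instance _ = nonZeroIndex i
rimNext⁺ {m} {i} (inj₂ (e , i+1≡m)) = trans e (sym (trans (cong (_% m) i+1≡m) (n%n≡0 m)))
  where instance _ = nonZeroIndex i

rimNext-functional : ∀ {m} {i j k : Fin m} → RimNext i j → RimNext i k → j ≡ k
rimNext-functional e f = toℕ-injective (trans e (sym f))

rimNext-injective : ∀ {m} {i j k : Fin m} → RimNext i k → RimNext j k → i ≡ j
rimNext-injective {m} e f = toℕ-injective (steps (rimNext⁻ e) (rimNext⁻ f))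
  where
  steps : ∀ {a b c} → c ≡ suc a ⊎ (c ≡ 0 × suc a ≡ m) → c ≡ suc b ⊎ (c ≡ 0 × suc b ≡ m) → a ≡ b
  steps (inj₁ refl)          (inj₁ refl)       = refl
  steps (inj₁ refl)          (inj₂ (() , _))
  steps (inj₂ (refl , _))    (inj₁ ())
  steps (inj₂ (refl , refl)) (inj₂ (_ , refl)) = refl

rim-successor : ∀ {m} (i : Fin m) → ∃[ j ] RimNext i j
rim-successor {m} i = fromℕ< i+1%m<m , toℕ-fromℕ< i+1%m<m
  where
  instance _ = nonZeroIndex i
  i+1%m<m = m%n<n (suc (toℕ i)) m

rim-predecessor : ∀ {m} (j : Fin m) → ∃[ i ] RimNext i j
rim-predecessor {suc m} zero    = fromℕ m , rimNext⁺ {i = fromℕ m} (inj₂ (refl , cong suc (toℕ-fromℕ m)))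
rim-predecessor {suc m} (suc j) = inject₁ j , rimNext⁺ {i = inject₁ j} (inj₁ (cong suc (sym (toℕ-inject₁ j))))

-- Excluded when 4 ≤ m; with `rim-3-cycle` this makes rim vertices two steps apart distinct and
-- nonadjacent.
rim-2-cycle : ∀ {m} {i j : Fin m} → RimNext i j → RimNext j i → m ≤ 2
rim-2-cycle {m} e f = steps (rimNext⁻ e) (rimNext⁻ f)
  where
  steps : ∀ {a b} → b ≡ suc a ⊎ (b ≡ 0 × suc a ≡ m) → a ≡ suc b ⊎ (a ≡ 0 × suc b ≡ m) → m ≤ 2
  steps (inj₁ refl)          (inj₁ ())
  steps (inj₁ refl)          (inj₂ (refl , refl)) = ≤ᵇ⇒≤ 2 2 _
  steps (inj₂ (refl , refl)) (inj₁ refl)          = ≤ᵇ⇒≤ 2 2 _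
  steps (inj₂ (refl , refl)) (inj₂ (refl , _))    = ≤ᵇ⇒≤ 1 2 _

rim-3-cycle : ∀ {m} {i j k : Fin m} → RimNext i j → RimNext j k → RimNext k i → m ≤ 3
rim-3-cycle {m} e f g = steps (rimNext⁻ e) (rimNext⁻ f) (rimNext⁻ g)
  where
  steps : ∀ {a b c} → b ≡ suc a ⊎ (b ≡ 0 × suc a ≡ m) → c ≡ suc b ⊎ (c ≡ 0 × suc b ≡ m) →
          a ≡ suc c ⊎ (a ≡ 0 × suc c ≡ m) → m ≤ 3
  steps (inj₁ refl) (inj₁ refl) (inj₁ ())
  steps (inj₁ refl) (inj₁ refl) (inj₂ (refl , refl)) = ≤ᵇ⇒≤ 3 3 _
  steps (inj₁ refl) (inj₂ (refl , refl)) (inj₁ refl) = ≤ᵇ⇒≤ 3 3 _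
  steps (inj₁ refl) (inj₂ (refl , refl)) (inj₂ (refl , ()))
  steps (inj₂ (refl , refl)) (inj₁ refl) (inj₁ refl) = ≤ᵇ⇒≤ 3 3 _
  steps (inj₂ (refl , refl)) (inj₁ refl) (inj₂ (refl , ()))
  steps (inj₂ (refl , eq)) (inj₂ (refl , refl)) _ = ≤ᵇ⇒≤ 1 3 _

Independent : ∀ {m} → Subset m → Set
Independent x = ∀ {i j} → RimNext i j → i ∈ x → j ∉ x

independent⇒apart : ∀ {m} (x : Subset m) → Independent x → Apart (gaps x)
independent⇒apart x ind = cyclic-apart⁺ 0 x
  ( (λ {i} {j} c i∈ j∈ → ind {i} {j} (rimNext⁺ {i = i} {j} (inj₁ c)) i∈ j∈)
  , (λ {i} {j} w i∈ j∈ → ⊥-elim (ind {i} {j} (rimNext⁺ {i = i} {j} (inj₂ w)) i∈ j∈)))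

apart⇒independent : ∀ {m} (x : Subset m) → Apart (gaps x) → Independent x
apart⇒independent x apart {i} {j} e i∈ j∈ with cyclic-apart⁻ 0 x apart | rimNext⁻ {i = i} {j} e
... | next , _    | inj₁ c = next c i∈ j∈
... | _    , wrap | inj₂ w with () ← wrap w i∈ j∈

-- Convexity in the wheel

module _ {m : ℕ} (4≤m : 4 ≤ m) where

  private
    G = W (suc m) (s≤s 4≤m)
  open Graph G

  adj⇒≢ : ∀ {u v} → Adj u v → u ≢ v
  adj⇒≢ a refl = adj-irrefl a

  twoEdges-shortest : ∀ {u w v} (a : Adj u w) (b : Adj w v) → u ≢ v → ¬ Adj u v →
                      IsShortestPath G (a ◅ b ◅ ε)
  twoEdges-shortest a b u≢v ¬adj =
    (adj⇒≢ a ∷ u≢v ∷ []) ∷ (adj⇒≢ b ∷ []) ∷ [] ∷ [] ,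
    λ { ε _ → ⊥-elim (u≢v refl) ; (c ◅ ε) _ → ⊥-elim (¬adj c) ; (_ ◅ _ ◅ _) _ → s≤s (s≤s z≤n) }

  convex-middle : ∀ {K u w v} → Convex G K → u ∈ K → v ∈ K → Adj u w → Adj w v →
                  u ≢ v → ¬ Adj u v → w ∈ K
  convex-middle convex u∈ v∈ a b u≢v ¬adj
    with convex u∈ v∈ (a ◅ b ◅ ε) (twoEdges-shortest a b u≢v ¬adj)
  ... | _ ∷ w∈ ∷ _ = w∈

  rim-distance-2 : ∀ {h i k : Fin m} → RimNext h i → RimNext i k →
                   Fin.suc h ≢ suc k × ¬ Adj (suc h) (suc k)
  rim-distance-2 {h} {i} {k} e f =
    (λ { refl → <⇒≱ (≤ᵇ⇒≤ 3 4 _) (≤-trans 4≤m (rim-2-cycle {i = h} {i} e f)) }) ,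
    (λ { (rim-next g) → adj-irrefl {suc i}
           (rim-next (subst (RimNext i) (sym (rimNext-functional {i = h} {i} {k} e g)) f))
       ; (rim-prev g) → <⇒≱ (s≤s (≤ᵇ⇒≤ 3 3 _)) (≤-trans 4≤m (rim-3-cycle {i = h} {i} {k} e f g)) })

  -- A selected rim vertex is the middle of a shortest path between its two unselected rim
  -- neighbours. Once the whole rim is in K, the center follows in the same way from two rim
  -- vertices two steps apart.
  independent⇒hull : ∀ {b} (x : Subset m) → Independent x → IsConvexHull G (∁ (b ∷ x)) ⊤
  independent⇒hull {b} x ind = (λ _ _ p _ → universal (λ _ → ∈⊤) (vertices G p)) , (λ _ → ∈⊤) , minimal
    where
    minimal : ∀ K → Convex G K → ∁ (b ∷ x) ⊆ K → ⊤ ⊆ K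
    minimal K convex ⊆K {v} _ = every v
      where
      unselected : ∀ {i} → i ∉ x → suc i ∈ K
      unselected i∉ = ⊆K (x∉p⇒x∈∁p (i∉ ∘ drop-there))

      rim : ∀ i → suc i ∈ K
      rim i with i ∈ₛ? x
      ... | no i∉ = unselected i∉
      ... | yes i∈ =
        let h , e = rim-predecessor i
            k , f = rim-successor i
            h≢k , ¬adj = rim-distance-2 {h} {i} {k} e f
        in convex-middle convex
             (unselected (λ h∈ → ind {h} {i} e h∈ i∈)) (unselected (ind {i} {k} f i∈))
             (rim-next e) (rim-next f) h≢k ¬adj

      every : ∀ v → v ∈ K
      every (suc i) = rim i
      every zero =
        let h = fromℕ< (≤-trans (s≤s z≤n) 4≤m)
            i , e = rim-successor h
            k , f = rim-successor i
            h≢k , ¬adj = rim-distance-2 {h} {i} {k} e f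
        in convex-middle convex (rim h) (rim k) rim-center center-rim h≢k ¬adj

  -- Paths through the center bound the diameter by two, so convexity only has to be tested on paths
  -- of at most two edges.
  path≤2 : ∀ u v → ∃[ p ] (IsPath G {u} {v} p × walkLength G p ≤ 2)
  path≤2 zero    zero    = ε , [] ∷ [] , z≤n
  path≤2 zero    (suc j) = center-rim ◅ ε , ((λ ()) ∷ []) ∷ [] ∷ [] , s≤s z≤n
  path≤2 (suc i) zero    = rim-center ◅ ε , ((λ ()) ∷ []) ∷ [] ∷ [] , s≤s z≤n
  path≤2 (suc i) (suc j) with i Fin.≟ j
  ... | yes refl = ε , [] ∷ [] , z≤n
  ... | no i≢j   = rim-center ◅ center-rim ◅ ε ,
    ((λ ()) ∷ (i≢j ∘ Fin-suc-injective) ∷ []) ∷ ((λ ()) ∷ []) ∷ [] ∷ [] , s≤s (s≤s z≤n)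

  -- A shortest path of two edges through a rim vertex does not end at the center, which is adjacent
  -- to the whole rim. So it joins two distinct rim neighbours of its middle; for either vertex of
  -- the pair, one of these is the other vertex of the pair and lies outside K.
  rim-pair-complement-convex : ∀ {i j} → RimNext i j → Convex G (∁ (⁅ suc i ⁆ ∪ ⁅ suc j ⁆))
  rim-pair-complement-convex {i} {j} e = convex
    where
    K = ∁ (⁅ Fin.suc i ⁆ ∪ ⁅ suc j ⁆)

    ∈K : ∀ {v} → v ≢ suc i → v ≢ suc j → v ∈ K
    ∈K v≢i v≢j = x∉p⇒x∈∁p λ v∈ → case (x∈p∪q⁻ ⁅ suc i ⁆ ⁅ suc j ⁆ v∈)
      where
      case : _ → _
      case (inj₁ v∈) = v≢i (x∈⁅y⁆⇒x≡y _ v∈)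
      case (inj₂ v∈) = v≢j (x∈⁅y⁆⇒x≡y _ v∈)

    ≢i : ∀ {v} → v ∈ K → v ≢ suc i
    ≢i v∈ refl = x∈∁p⇒x∉p v∈ (x∈p∪q⁺ (inj₁ (x∈⁅x⁆ _)))

    ≢j : ∀ {v} → v ∈ K → v ≢ suc j
    ≢j v∈ refl = x∈∁p⇒x∉p v∈ (x∈p∪q⁺ {p = ⁅ suc i ⁆} (inj₂ (x∈⁅x⁆ _)))

    neighbour-of-i : ∀ {a} → suc a ∈ K → Adj (suc a) (suc i) → RimNext a i
    neighbour-of-i a∈ (rim-next f) = f
    neighbour-of-i {a} a∈ (rim-prev f) =
      ⊥-elim (≢j a∈ (cong suc (rimNext-functional {i = i} {a} {j} f e)))

    neighbour-of-j : ∀ {a} → suc a ∈ K → Adj (suc a) (suc j) → RimNext j a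
    neighbour-of-j a∈ (rim-prev f) = f
    neighbour-of-j {a} a∈ (rim-next f) =
      ⊥-elim (≢i a∈ (cong suc (rimNext-injective {i = a} {i} {j} f e)))

    middle : ∀ {u w v} → u ∈ K → v ∈ K → (a : Adj u w) (b : Adj w v) →
             IsShortestPath G (a ◅ b ◅ ε) → w ∈ K
    middle {w = zero} _ _ _ _ _ = ∈K (λ ()) (λ ())
    middle {zero} {suc k} {zero} _ _ _ _ ((_ ∷ u≢v ∷ []) ∷ _ , _) = ⊥-elim (u≢v refl)
    middle {zero} {suc k} {suc c} _ _ _ _ ((_ ∷ u≢v ∷ []) ∷ _ , min) =
      ⊥-elim (<⇒≱ (s≤s (s≤s z≤n)) (min (center-rim ◅ ε) ((u≢v ∷ []) ∷ [] ∷ [])))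
    middle {suc a} {suc k} {zero} _ _ _ _ ((_ ∷ u≢v ∷ []) ∷ _ , min) =
      ⊥-elim (<⇒≱ (s≤s (s≤s z≤n)) (min (rim-center ◅ ε) ((u≢v ∷ []) ∷ [] ∷ [])))
    middle {suc a} {suc k} {suc c} a∈ c∈ p q ((_ ∷ u≢v ∷ []) ∷ _ , _) = ∈K
      (λ { refl → u≢v (cong suc (rimNext-injective {i = a} {c} {i}
                    (neighbour-of-i a∈ p) (neighbour-of-i c∈ (adj-sym q)))) })
      (λ { refl → u≢v (cong suc (rimNext-functional {i = j} {a} {c}
                    (neighbour-of-j a∈ p) (neighbour-of-j c∈ (adj-sym q)))) })

    convex : Convex G K
    convex u∈ v∈ ε _ = u∈ ∷ []
    convex u∈ v∈ (a ◅ ε) _ = u∈ ∷ v∈ ∷ []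
    convex u∈ v∈ (a ◅ b ◅ ε) shortest = u∈ ∷ middle u∈ v∈ a b shortest ∷ v∈ ∷ []
    convex {u} {v} u∈ v∈ (_ ◅ _ ◅ _ ◅ _) (_ , min) =
      let q , path , short = path≤2 u v
      in ⊥-elim (<⇒≱ (s≤s (s≤s (s≤s z≤n))) (≤-trans (min q path) short))

  -- Two adjacent selected rim vertices would confine the hull of the complement to the convex
  -- complement of the pair.
  hull⇒independent : ∀ {b} (x : Subset m) → IsConvexHull G (∁ (b ∷ x)) ⊤ → Independent x
  hull⇒independent {b} x (_ , _ , minimal) {i} {j} e i∈ j∈ =
    x∈∁p⇒x∉p (minimal _ (rim-pair-complement-convex {i} {j} e) ∁P⊆K {suc i} ∈⊤)
      (x∈p∪q⁺ (inj₁ (x∈⁅x⁆ _)))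
    where
    ∁P⊆K : ∁ (b ∷ x) ⊆ ∁ (⁅ suc i ⁆ ∪ ⁅ suc j ⁆)
    ∁P⊆K {v} v∈ = x∉p⇒x∈∁p (selected ∘ x∈p∪q⁻ ⁅ suc i ⁆ ⁅ suc j ⁆)
      where
      selected : ¬ (v ∈ ⁅ suc i ⁆ ⊎ v ∈ ⁅ suc j ⁆)
      selected (inj₁ v∈i) with refl ← x∈⁅y⁆⇒x≡y (suc i) v∈i = x∈∁p⇒x∉p v∈ (there i∈)
      selected (inj₂ v∈j) with refl ← x∈⁅y⁆⇒x≡y (suc j) v∈j = x∈∁p⇒x∉p v∈ (there j∈)

-- Nim-values of the positions

-- Selecting the center is a pass that is available once: a nim-heap of size 1.
center : Bool → Nimber 4
center true  = 𝟎
center false = bits 4 1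

CenterOption : Bool → Nimber 4 → Set
CenterOption b c = b ≡ false × c ≡ center true

center-mex : ∀ b → Mex (CenterOption b) (center b)
center-mex true  = (λ ()) , ⊥-elim ∘ 𝟎-minimal {4}
center-mex false = (λ ()) , below
  where
  below : ∀ {c} → c ≺ center false → CenterOption false c
  below (there (there (there (here {a = []})))) = refl , refl

GameOption : Bool → List ℕ → Nimber 4 → Set
GameOption b gs = Sum (GapsOption gs) (value gs) (CenterOption b) (center b)

apart? : ∀ gs → Dec (Apart gs)
apart? = all? (1 ≤?_)

-- On an empty rim one move cannot produce an adjacent pair, so the shift by one does not apply and
-- the values are set apart.
emptyRimNim : ℕ → Bool → ℕ
emptyRimNim m true  = 0
emptyRimNim m false = if does (⟦ dawson (m ∸ 2) ⟧ ≟ 1) then 2 else 1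

-- As long as some rim vertex is selected, the nim-value 0 of a terminal position
-- is among the options; this shifts all other values by one.
gapsNim : ℕ → Bool → List ℕ → ℕ
gapsNim m b []         = emptyRimNim m b
gapsNim m b gs@(_ ∷ _) = if does (apart? gs) then suc ⟦ value gs ⊕ center b ⟧ else 0

terNim : ∀ {m} → Subset (suc m) → ℕ
terNim {m} (b ∷ x) = gapsNim m b (gaps x)

gapsNim-apart : ∀ m b {gs} → gs ≢ [] → Apart gs → gapsNim m b gs ≡ suc ⟦ value gs ⊕ center b ⟧
gapsNim-apart m b {[]}     ne _     = ⊥-elim (ne refl)
gapsNim-apart m b {g ∷ gs} _  apart rewrite dec-true (apart? (g ∷ gs)) apart = refl

gapsNim-¬apart : ∀ m b {gs} → ¬ Apart gs → gapsNim m b gs ≡ 0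
gapsNim-¬apart m b {[]}     ¬apart = ⊥-elim (¬apart [])
gapsNim-¬apart m b {g ∷ gs} ¬apart rewrite dec-false (apart? (g ∷ gs)) ¬apart = refl

cyclic-nonempty : ∀ {k} l {x : Subset k} → Nonempty x → cyclic l x ≢ []
cyclic-nonempty l {false ∷ x} (suc v , there v∈) eq = cyclic-nonempty (suc l) (v , v∈) eq
cyclic-nonempty l {true ∷ x}  _ eq = segment-nonempty 0 l x eq
  where
  segment-nonempty : ∀ {k} r e (x : Subset k) → segment r e x ≢ []
  segment-nonempty r e (false ∷ x) = segment-nonempty (suc r) e x

terNim-center : ∀ {m} (x : Subset m) →
                terNim ((false ∷ x) ∪ ⁅ zero ⁆) ≡ gapsNim m true (gaps x)
terNim-center {m} x = cong (gapsNim m true ∘ gaps) (∪-identityʳ x)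

terNim-rim : ∀ {m} b (x : Subset m) v →
             terNim ((b ∷ x) ∪ ⁅ suc v ⁆) ≡ gapsNim m b (gaps (x ∪ ⁅ v ⁆))
terNim-rim {m} b x v = cong (λ b′ → gapsNim m b′ (gaps (x ∪ ⁅ v ⁆))) (∨-identityʳ b)

module _ {m : ℕ} (4≤m : 4 ≤ m) where

  private
    G = W (suc m) (s≤s 4≤m)

  OptionNim : Subset (suc m) → ℕ → Set
  OptionNim P k = ∃[ Q ] (TERMove G P Q × terNim Q ≡ k)

  module _ {x : Subset m} (independent : Independent x) where

    center-option : OptionNim (false ∷ x) (gapsNim m true (gaps x))
    center-option = _ , (independent⇒hull 4≤m x independent , zero , (λ ()) , refl) ,
      terNim-center x

    rim-option : ∀ b {v} → v ∉ x → OptionNim (b ∷ x) (gapsNim m b (gaps (x ∪ ⁅ v ⁆)))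
    rim-option b {v} v∉ = _ ,
      (independent⇒hull 4≤m x independent , suc v , v∉ ∘ drop-there , refl) , terNim-rim b x v

  option⁻ : ∀ {b} (x : Subset m) {k} → OptionNim (b ∷ x) k →
            (b ≡ false × k ≡ gapsNim m true (gaps x)) ⊎
            (∃[ v ] (v ∉ x × k ≡ gapsNim m b (gaps (x ∪ ⁅ v ⁆))))
  option⁻ {false} x (_ , (_ , zero , _ , refl) , refl)  = inj₁ (refl , terNim-center x)
  option⁻ {true}  x (_ , (_ , zero , v∉ , _) , _)       = ⊥-elim (v∉ here)
  option⁻ {b}     x (_ , (_ , suc v , v∉ , refl) , refl) = inj₂ (v , v∉ ∘ there , terNim-rim b x v)

  terminal-mex : ∀ {b} (x : Subset m) → ¬ Apart (gaps x) →
                 IsMex (OptionNim (b ∷ x)) (gapsNim m b (gaps x))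
  terminal-mex {b} x ¬apart = subst (IsMex _) (sym (gapsNim-¬apart m b ¬apart))
    ((λ { (_ , (hull , _) , _) →
            ¬apart (independent⇒apart x (hull⇒independent 4≤m x hull)) }) , (λ ()))

  -- The nonterminal options have the values of the options of a sum of games, shifted by one; the
  -- terminal ones supply 0. So the mex is shifted by one too.
  nonempty-mex : ∀ b (x : Subset m) → Nonempty x → Apart (gaps x) →
                 IsMex (OptionNim (b ∷ x)) (gapsNim m b (gaps x))
  nonempty-mex b x nonempty apart =
    subst (IsMex _) (sym (gapsNim-apart m b gaps≢[] apart)) (not , below)
    where
    gaps≢[] = cyclic-nonempty 0 nonempty
    a = value (gaps x)
    mex : Mex (GameOption b (gaps x)) (a ⊕ center b)
    mex = Mex-⊕ (value-mex apart) (center-mex b)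
    independent : Independent x
    independent {i} {j} = apart⇒independent x apart {i} {j}

    selected≢[] : ∀ v → gaps (x ∪ ⁅ v ⁆) ≢ []
    selected≢[] v = cyclic-nonempty 0 (v , x∈p∪q⁺ {p = x} (inj₂ (x∈⁅x⁆ v)))

    not : ¬ OptionNim (b ∷ x) (suc ⟦ a ⊕ center b ⟧)
    not o with option⁻ x o
    ... | inj₁ (refl , e) = proj₁ mex (inj₂ (_ , (refl , refl) ,
      ⟦⟧-injective _ _ (suc-injective (sym (trans e (gapsNim-apart m true gaps≢[] apart))))))
    ... | inj₂ (v , v∉ , e) with apart? (gaps (x ∪ ⁅ v ⁆))
    ...   | no ¬apart with () ← trans e (gapsNim-¬apart m b ¬apart)
    ...   | yes apart′ =
      let gs , move , p = cyclic-move 0 x nonempty v∉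
      in proj₁ mex (inj₁ (_ , (gs , move , All-resp-↭ (↭-sym p) apart′ , value-↭ p) ,
           ⟦⟧-injective _ _ (suc-injective (sym (trans e (gapsNim-apart m b (selected≢[] v) apart′))))))

    adjacent-option : ∀ {gs} → gs ≡ gaps x → Apart gs → gs ≢ [] → OptionNim (b ∷ x) 0
    adjacent-option {[]}         _  _ gs≢[] = ⊥-elim (gs≢[] refl)
    adjacent-option {zero ∷ gs}  _  (() ∷ _) _
    adjacent-option {suc g ∷ gs} eq _ _
      -- Selecting the first vertex of a positive gap, right beside a selected one, leaves a gap of
      -- size 0.
      with v , v∉ , p ← gaps-move⁻ x (subst (_⇒ 0 ∷ g ∷ gs) eq (split 0 g refl)) =
      subst (OptionNim _) (gapsNim-¬apart m b λ apart′ → ¬zero (All-resp-↭ (↭-sym p) apart′))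
        (rim-option (λ {i} {j} → independent {i} {j}) b v∉)
      where
      ¬zero : ∀ {gs} → ¬ Apart (0 ∷ gs)
      ¬zero (() ∷ _)

    reach : ∀ {c} → GameOption b (gaps x) c → OptionNim (b ∷ x) (suc ⟦ c ⟧)
    reach (inj₁ (_ , (gs , move , apart′ , refl) , refl)) =
      let v , v∉ , p = gaps-move⁻ x move in
      subst (OptionNim _)
        (trans (gapsNim-apart m b (selected≢[] v) (All-resp-↭ p apart′))
          (cong (λ c → suc ⟦ c ⊕ center b ⟧) (sym (value-↭ p))))
        (rim-option (λ {i} {j} → independent {i} {j}) b v∉)
    reach (inj₂ (_ , (refl , refl) , refl)) =
      subst (OptionNim _) (gapsNim-apart m true gaps≢[] apart)
        (center-option (λ {i} {j} → independent {i} {j}))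

    below : ∀ {k} → k < suc ⟦ a ⊕ center b ⟧ → OptionNim (b ∷ x) k
    below {zero}  _         = adjacent-option refl apart gaps≢[]
    below {suc k} (s≤s k<) with c , c≺ , refl ← <⇒≺ (a ⊕ center b) k< = reach (proj₂ mex c≺)

  -- A single selected vertex leaves one gap of m - 1 vertices, whichever vertex it is, and so a row
  -- of m - 2 skittles.
  first-rim-nim : ∀ b v → gapsNim m b (gaps (⊥ ∪ ⁅ v ⁆)) ≡ suc ⟦ dawson (m ∸ 2) ⊕ center b ⟧
  first-rim-nim b v = trans (cong (gapsNim m b) (single 4≤m v))
    (trans (gapsNim-apart m b (λ ()) (∸-monoˡ-≤ 1 (≤-trans (s≤s (s≤s z≤n)) 4≤m) ∷ []))
      (cong (λ d → suc ⟦ d ⊕ center b ⟧) (trans (⊕-identityʳ _) (cong dawson (pred[m∸n]≡m∸[1+n] m 1)))))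
    where
    single : ∀ {m} → 4 ≤ m → (v : Fin m) → gaps (⊥ ∪ ⁅ v ⁆) ≡ m ∸ 1 ∷ []
    single {suc m} _ v = trans (cong gaps (∪-identityˡ ⁅ v ⁆))
      (trans (cyclic-⁅⁆ 0 v) (cong (_∷ []) (+-identityʳ m)))

  ⊥-independent : Independent {m} ⊥
  ⊥-independent _ i∈ = ⊥-elim (∉⊥ i∈)

  gapsNim-⊥ : ∀ b → gapsNim m b (gaps {m} ⊥) ≡ emptyRimNim m b
  gapsNim-⊥ b = cong (gapsNim m b) (cyclic-⊥ m 0)

  empty-mex : ∀ b → IsMex (OptionNim (b ∷ ⊥)) (emptyRimNim m b)
  -- With the center gone only rim selections remain, all of positive value.
  empty-mex true = not , (λ ())
    where
    not : ¬ OptionNim (true ∷ ⊥) 0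
    not o with option⁻ ⊥ o
    ... | inj₂ (v , _ , e) with () ← trans e (first-rim-nim true v)
  empty-mex false with ⟦ dawson (m ∸ 2) ⟧ ≟ 1
  ... | yes d≡1 = subst (IsMex _) (cong (if_then 2 else 1) (sym (dec-true (_ ≟ _) d≡1))) (not , below)
    where
    rim≡1 : ∀ v → gapsNim m false (gaps (⊥ ∪ ⁅ v ⁆)) ≡ 1
    rim≡1 v = trans (first-rim-nim false v)
      (cong (λ d → suc ⟦ d ⊕ center false ⟧) (⟦⟧-injective (dawson (m ∸ 2)) (center false) d≡1))
    not : ¬ OptionNim (false ∷ ⊥) 2
    not o with option⁻ ⊥ o
    ... | inj₁ (_ , e)     with () ← trans e (gapsNim-⊥ true)
    ... | inj₂ (v , _ , e) with () ← trans e (rim≡1 v)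
    below : ∀ {k} → k < 2 → OptionNim (false ∷ ⊥) k
    below {0} _ = subst (OptionNim _) (gapsNim-⊥ true) (center-option ⊥-independent)
    below {1} _ = subst (OptionNim _) (rim≡1 v₀) (rim-option ⊥-independent false ∉⊥)
      where v₀ = fromℕ< (≤-trans (s≤s z≤n) 4≤m)
    below {suc (suc _)} (s≤s (s≤s ()))
  ... | no d≢1 = subst (IsMex _) (cong (if_then 2 else 1) (sym (dec-false (_ ≟ _) d≢1))) (not , below)
    where
    not : ¬ OptionNim (false ∷ ⊥) 1
    not o with option⁻ ⊥ o
    ... | inj₁ (_ , e)     with () ← trans e (gapsNim-⊥ true)
    -- A rim option of value 1 means d ⊕ 1 = 0, hence d = 1.
    ... | inj₂ (v , _ , e) = d≢1 (cong ⟦_⟧ (⊕-injectiveˡ (center false) {dawson (m ∸ 2)} {center false}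
      (⟦⟧-injective _ 𝟎 (sym (suc-injective (trans e (first-rim-nim false v)))))))
    below : ∀ {k} → k < 1 → OptionNim (false ∷ ⊥) k
    below {0} _ = subst (OptionNim _) (gapsNim-⊥ true) (center-option ⊥-independent)
    below {suc _} (s≤s ())

  terNim-isNim : IsNim (TER G) terNim
  terNim-isNim (b ∷ x) _ with nonempty? x
  ... | no empty with refl ← Empty-unique empty = subst (IsMex _) (sym (gapsNim-⊥ b)) (empty-mex b)
  ... | yes nonempty with apart? (gaps x)
  ...   | no ¬apart = terminal-mex x ¬apart
  ...   | yes apart = nonempty-mex b x nonempty apart

-- The answer in terms of n

-- Reduces an identity of eventually periodic functions to finitely many cases.
periodic-agree : ∀ p N → 0 < p → {A : Set} (f g : ℕ → A) →
                 (∀ {s} → N ≤ s → f (p + s) ≡ f s) → (∀ {s} → N ≤ s → g (p + s) ≡ g s) →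
                 (∀ {s} → s < p + N → f s ≡ g s) → ∀ s → f s ≡ g s
periodic-agree p N 0<p f g f-periodic g-periodic initial = <-rec _ step
  where
  step : ∀ s → (∀ {t} → t < s → f t ≡ g t) → f s ≡ g s
  step s rec with s <? p + N
  ... | yes s< = initial s<
  ... | no  s≮ = trans (cong f s≡) (trans (f-periodic N≤t)
                   (trans (rec t<s) (trans (sym (g-periodic N≤t)) (cong g (sym s≡)))))
    where
    t = s ∸ p
    s≡ : s ≡ p + t
    s≡ = sym (m+[n∸m]≡n (≤-trans (m≤m+n p N) (≮⇒≥ s≮)))
    N≤t : N ≤ t
    N≤t = +-cancelˡ-≤ p N t (subst (p + N ≤_) s≡ (≮⇒≥ s≮))
    t<s : t < s
    t<s = subst (t <_) (sym s≡) (m<n+m t 0<p)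

-- For n = m + 1 the argument `n ∸ 3` is the `m ∸ 2` of `emptyRimNim`.
dawsonIsOne : ℕ → Bool
dawsonIsOne n = does (⟦ dawson (n ∸ 3) ⟧ ≟ 1)

isExceptional : ℕ → Bool
isExceptional n = does (_∈?_ _≟_ (n % 34) (5 ∷ 6 ∷ 10 ∷ 11 ∷ 25 ∷ 26 ∷ 30 ∷ 31 ∷ []))

opaque
  unfolding dawson

  -- 90 = 34 + 56, where 56 = 53 + 3 is the start of the periodic range in terms of n.
  dawsonIsOne-initial : ∀ {n} → n < 90 → dawsonIsOne n ≡ isExceptional n
  dawsonIsOne-initial =
    toWitness {a? = allUpTo? (λ n → dawsonIsOne n ≟ᵇ isExceptional n) 90} _

dawsonIsOne-periodic : ∀ {n} → 56 ≤ n → dawsonIsOne (34 + n) ≡ dawsonIsOne n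
dawsonIsOne-periodic {n} 56≤n = cong (λ d → does (⟦ d ⟧ ≟ 1))
  (trans (cong dawson (+-∸-assoc 34 (≤-trans (m≤m+n 3 53) 56≤n))) (dawson-periodic (∸-monoˡ-≤ 3 56≤n)))

isExceptional-periodic : ∀ n → isExceptional (34 + n) ≡ isExceptional n
isExceptional-periodic n = cong (λ r → does (_∈?_ _≟_ r (5 ∷ 6 ∷ 10 ∷ 11 ∷ 25 ∷ 26 ∷ 30 ∷ 31 ∷ [])))
  (trans (cong (_% 34) (+-comm 34 n)) ([m+n]%n≡m%n n 34))

dawsonIsOne≡isExceptional : ∀ n → dawsonIsOne n ≡ isExceptional n
dawsonIsOne≡isExceptional = periodic-agree 34 56 (s≤s z≤n) dawsonIsOne isExceptional
  dawsonIsOne-periodic (λ {n} _ → isExceptional-periodic n) dawsonIsOne-initial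

theorem5p29 : (n : ℕ) (n≥5 : 5 ≤ n) →
    HasNimValue (TER (W n n≥5))
    (if does (_∈?_ _≟_ (n % 34) (5 ∷ 6 ∷ 10 ∷ 11 ∷ 25 ∷ 26 ∷ 30 ∷ 31 ∷ []))
    then 2 else 1)
theorem5p29 (suc m) (s≤s 4≤m) = terNim , terNim-isNim 4≤m ,
  trans (gapsNim-⊥ 4≤m false) (cong (if_then 2 else 1) (dawsonIsOne≡isExceptional (suc m)))
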